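{- Consider the 62-trick cycle of states of two-player Beggar-My-Neighbor that passes through the state (top card of each hand at the left) Player 1: $\texttt{ ---AAJ--J--------K---------Q-Q-K---Q-KAQJ- }$ Player 2: $\texttt{ -----KA-J- }$ with player 2 to play next. There exist 30 pairwise distinct starting deals of a standard 52-card deck (26 cards to each player, with either player 1 or player 2 designated to start) such that the game played from each of them reaches a state on this cycle; consequently each of these 30 starting deals gives a non-terminating game.
   Context: Cards and hands. Suits are irrelevant. A card is one of: an ace $\texttt{A}$, a king $\texttt{K}$, a queen $\texttt{Q}$, a jack $\texttt{J}$ (these four types are the court, or face, cards), or a number card, written $\texttt{ - }$. A standard deck has 52 cards: 4 each of $\texttt{A},\texttt{K},\texttt{Q},\texttt{J}$ and 36 number cards. A hand (pack) is a finite sequence of cards, written as a string with the top of the hand (next card to be played) at the left. In the strings, each single hyphen is one number card. State. A state (between tricks) consists of the hand of player 1, the hand of player 2, and which player is to play next (start the next trick). A starting deal is a state in which each player has 26 cards and the two hands together form a standard deck; two starting deals are distinct if they differ as states (suits being ignored). Rules of Beggar-My-Neighbor. The player to start lays the top card of his hand face up on the (initially empty) table pile; the players then alternate, each laying the top card of his hand on the pile, as long as no court card appears. When a player lays a court card, his opponent has to pay: he must lay up to 4 cards in succession for an ace, 3 for a king, 2 for a queen, 1 for a jack, taken from the top of his hand. If all the required cards are number cards, the player who laid the court card wins the trick. If during the payment a court card is laid, the payment stops at once and the roles are reversed: the other player now has to pay to this new court card in the same way; the trick continues until some player pays in full with number cards only. The winner of the trick takes the whole pile and places it under (at the bottom of)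 his hand, in the order the cards were played (the first card played in the trick is nearest the top, so in string notation the pile, written in order of play, is appended at the right end of the winner's string). The winner of the trick starts the next trick. Termination. The game terminates if one player gets all the cards (in particular if a player who must lay a card has none left, in which case his opponent gets all the cards and wins). A game is non-terminating if it continues through infinitely many tricks. Play is deterministic. The cycle. Playing from the state displayed in the claim, the game returns to that same state for the first time after exactly 62 tricks; the cycle is the set of 62 states so visited. -}

module Defs where

open import Data.List.Base using (List; []; _∷_; _++_; _∷ʳ_; length; replicate)
open import Data.List.Relation.Binary.Permutation.Propositional using (_↭_)
open import Data.Maybe.Base using (Maybe; just; nothing; _>>=_)
open import Data.Nat.Base using (ℕ; zero; suc; _<_)
open import Data.Product.Base using (_×_; ∃-syntax)
open import Relation.Binary.PropositionalEquality.Core using (_≡_; _≢_)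

data Court : Set where
  ace king queen jack : Court

data Card : Set where
  court : Court → Card
  -     : Card  -- a number card

pattern A = court ace
pattern K = court king
pattern Q = court queen
pattern J = court jack

-- The head of the list is the top of the hand; a pile is listed in order of
-- play.
Hand Pile : Set
Hand = List Card
Pile = List Card

data Player : Set where
  player₁ player₂ : Player

opponent : Player → Player
opponent player₁ = player₂
opponent player₂ = player₁

record State : Set where
  constructor state
  field
    hand₁ hand₂ : Hand
    next        : Player

open State public

penalty : Court → ℕ
penalty ace   = 4
penalty king  = 3
penalty queen = 2
penalty jack  = 1

-- In the functions below, `p` is the player who acts, `xs` is the hand of `p`,
-- and `ys` is the hand of the opponent of `p`.

stateOf : (p : Player) (xs ys : Hand) (next : Player) → State
stateOf player₁ xs ys = state xs ys
stateOf player₂ xs ys = state ys xs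

-- `p` has paid in full, so the opponent of `p` wins the trick and starts the
-- next one.  If `p` has no card left then the winner holds all the cards and
-- the game terminates (`nothing`).
settle : (p : Player) (xs ys : Hand) → Pile → Maybe State
settle p []         ys pile = nothing
settle p xs@(_ ∷ _) ys pile = just (stateOf p xs (ys ++ pile) (opponent p))

-- `p` still owes n cards to the latest court card.  As in `alternate`, the
-- game terminates if `p` has to lay a card and has none.
pay : (n : ℕ) (p : Player) (xs ys : Hand) → Pile → Maybe State
pay zero    p xs             ys pile = settle p xs ys pile
pay (suc n) p []             ys pile = nothing
pay (suc n) p (-       ∷ xs) ys pile = pay n p xs ys (pile ∷ʳ -)
pay (suc n) p (court c ∷ xs) ys pile =
  pay (penalty c) (opponent p) ys xs (pile ∷ʳ court c)

-- No court card has been laid in this trick, and it is the turn of `p`.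
alternate : (p : Player) (xs ys : Hand) → Pile → Maybe State
alternate p []             ys pile = nothing
alternate p (-       ∷ xs) ys pile = alternate (opponent p) ys xs (pile ∷ʳ -)
alternate p (court c ∷ xs) ys pile =
  pay (penalty c) (opponent p) ys xs (pile ∷ʳ court c)

-- The state after one trick, or `nothing` if the game terminates in this trick.
playTrick : State → Maybe State
playTrick (state h₁ h₂ player₁) = alternate player₁ h₁ h₂ []
playTrick (state h₁ h₂ player₂) = alternate player₂ h₂ h₁ []

playTricks : ℕ → State → Maybe State
playTricks zero    s = just s
playTricks (suc n) s = playTrick s >>= playTricks n

NonTerminating : State → Set
NonTerminating s = ∀ n → ∃[ t ] playTricks n s ≡ just t

FirstReturn : ℕ → State → Set
FirstReturn n s =
  0 < n
  × playTricks n s ≡ just s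
  × (∀ k → 0 < k → k < n → playTricks k s ≢ just s)

standardDeck : List Card
standardDeck =
  replicate 4 A ++ replicate 4 K ++
  replicate 4 Q ++ replicate 4 J ++ replicate 36 -

StartingDeal : State → Set
StartingDeal s =
  length (hand₁ s) ≡ 26
  × length (hand₂ s) ≡ 26
  × hand₁ s ++ hand₂ s ↭ standardDeck

cycleState : State
cycleState = state
  (- ∷ - ∷ - ∷ A ∷ A ∷ J ∷ - ∷ - ∷ J ∷ - ∷ - ∷ - ∷ - ∷ - ∷
   - ∷ - ∷ - ∷ K ∷ - ∷ - ∷ - ∷ - ∷ - ∷ - ∷ - ∷ - ∷ - ∷ Q ∷
   - ∷ Q ∷ - ∷ K ∷ - ∷ - ∷ - ∷ Q ∷ - ∷ K ∷ A ∷ Q ∷ J ∷ - ∷ [])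
  (- ∷ - ∷ - ∷ - ∷ - ∷ K ∷ A ∷ - ∷ J ∷ - ∷ [])
  player₂

OnCycle : State → Set
OnCycle s = ∃[ k ] (k < 62 × playTricks k cycleState ≡ just s)

ReachesCycle : State → Set
ReachesCycle s = ∃[ n ] ∃[ t ] (playTricks n s ≡ just t × OnCycle t)

{-# OPTIONS --safe #-}

-- The deals come from playing the cycle backwards.  A trick can be undone by
-- taking back from the last winner's hand any suffix that is a complete trick;
-- since such a suffix ends in a court card c followed by exactly `penalty c`
-- number cards, the tree of predecessors of the cycle is finite (of height 6),
-- and its nodes with 26 cards in each hand are exactly 30.  What remains is
-- decidable and is settled by evaluation, apart from non-termination, for which
-- the property "some positive number of tricks leads to c" is an invariant of
-- play as soon as the state c has it.

module Submission where

open import Defs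
open import Data.Bool.Base using (if_then_else_)
open import Data.Char.Base using (Char)
open import Data.List.Base using (List; _++_; length; map)
open import Data.List.Properties using () renaming (≡-dec to List-≡-dec)
open import Data.List.Relation.Binary.Permutation.Propositional using (_↭_; ↭-sym; ↭-trans; ↭-reflexive)
open import Data.Maybe.Base using (just)
open import Data.Maybe.Properties using (just-injective) renaming (≡-dec to Maybe-≡-dec)
open import Data.Nat.Base using (ℕ; zero; suc; _<_; s<s⁻¹; z<s)
open import Data.Nat.Properties using (≤-decTotalOrder; anyUpTo?; allUpTo?) renaming (_≟_ to _≟ℕ_)
open import Data.Product.Base using (_×_; _,_; ∃-syntax)
open import Data.String using (String; toList; fromChar; _==_)
open import Data.Vec.Base using (Vec; []; _∷_)
open import Data.Vec.Relation.Unary.All as All using (All)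
open import Data.Vec.Relation.Unary.AllPairs using (allPairs?)
open import Data.Vec.Relation.Unary.Unique.Propositional using (Unique)
open import Relation.Binary.Construct.On using (decTotalOrder)
open import Relation.Binary.Definitions using (DecidableEquality)
open import Relation.Binary.PropositionalEquality using (_≡_; _≢_; refl; sym; trans; cong)
open import Relation.Nullary.Decidable using (Dec; yes; no; map′; from-yes; ¬?; _×-dec_)

-- The four penalties are distinct and positive, so with 0 for number cards this codes cards
-- faithfully. The code supplies both the decidable equality of cards and the order for sorting
-- hands.
rank : Card → ℕ
rank -         = 0
rank (court c) = penalty c

unrank : ℕ → Card
unrank 1 = J
unrank 2 = Q
unrank 3 = K
unrank 4 = A
unrank _ = -

unrank-rank : ∀ c → unrank (rank c) ≡ c
unrank-rank - = refl
unrank-rank A = refl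
unrank-rank K = refl
unrank-rank Q = refl
unrank-rank J = refl

-- The left inverse `unrank` replaces a comparison of all 25 pairs of cards.
rank-injective : ∀ {c d} → rank c ≡ rank d → c ≡ d
rank-injective {c} {d} eq = trans (sym (unrank-rank c)) (trans (cong unrank eq) (unrank-rank d))

_≟ᶜ_ : DecidableEquality Card
c ≟ᶜ d = map′ rank-injective (cong rank) (rank c ≟ℕ rank d)

_≟ʰ_ : DecidableEquality Hand
_≟ʰ_ = List-≡-dec _≟ᶜ_

_≟ᵖ_ : DecidableEquality Player
player₁ ≟ᵖ player₁ = yes refl
player₁ ≟ᵖ player₂ = no λ ()
player₂ ≟ᵖ player₁ = no λ ()
player₂ ≟ᵖ player₂ = yes refl

_≟ˢ_ : DecidableEquality State
state xs ys p ≟ˢ state xs′ ys′ p′ =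
  map′ (λ { (refl , refl , refl) → refl }) (λ { refl → refl , refl , refl })
       ((xs ≟ʰ xs′) ×-dec (ys ≟ʰ ys′) ×-dec (p ≟ᵖ p′))

-- `Data.List.Sort` hides its algorithm behind `abstract`, which would block
-- evaluation.
open import Data.List.Sort.InsertionSort (decTotalOrder ≤-decTotalOrder rank) using (insertionSort)
open import Data.List.Sort.Base using (module SortingAlgorithm)
open SortingAlgorithm insertionSort using (sort; sort-↭)

-- Both lists are permutations of the common sorted list. Thus evaluation of one equality yields the
-- permutation with the standard deck.
sort-≡⇒↭ : ∀ {xs ys} → sort xs ≡ sort ys → xs ↭ ys
sort-≡⇒↭ {xs} {ys} eq = ↭-trans (↭-sym (sort-↭ xs)) (↭-trans (↭-reflexive eq) (sort-↭ ys))

StartingDealBySorting : State → Set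
StartingDealBySorting s =
  length (hand₁ s) ≡ 26
  × length (hand₂ s) ≡ 26
  × sort (hand₁ s ++ hand₂ s) ≡ sort standardDeck

startingDealBySorting? : ∀ s → Dec (StartingDealBySorting s)
startingDealBySorting? s =
  (length (hand₁ s) ≟ℕ 26) ×-dec (length (hand₂ s) ≟ℕ 26)
  ×-dec (sort (hand₁ s ++ hand₂ s) ≟ʰ sort standardDeck)

startingDealBySorting⇒startingDeal : ∀ s → StartingDealBySorting s → StartingDeal s
startingDealBySorting⇒startingDeal _ (l₁ , l₂ , sorted) = l₁ , l₂ , sort-≡⇒↭ sorted

LeadsTo : State → ℕ → State → Set
LeadsTo t n s = playTricks n s ≡ just t

leadsTo? : ∀ t n s → Dec (LeadsTo t n s)
leadsTo? t n s = Maybe-≡-dec _≟ˢ_ (playTricks n s) (just t)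

module _ (c : State) (m : ℕ) (period : LeadsTo c (suc m) c) where

  leadsToPeriodic⇒nonTerminating : ∀ n s → LeadsTo c (suc n) s → NonTerminating s
  leadsToPeriodic⇒nonTerminating n s s→c zero = s , refl
  leadsToPeriodic⇒nonTerminating n s s→c (suc k) with playTrick s
  -- The trick just played has arrived at `c`, so the count is exhausted and `period` restarts it. A
  -- positive count excludes `nothing` as the result of the next trick.
  leadsToPeriodic⇒nonTerminating zero    _ refl (suc k) | just _  =
    leadsToPeriodic⇒nonTerminating m c period k
  leadsToPeriodic⇒nonTerminating (suc n) _ s→c  (suc k) | just s′ =
    leadsToPeriodic⇒nonTerminating n s′ s→c k

cycleState-period : LeadsTo cycleState 62 cycleState
cycleState-period = refl

cycleState-firstReturn : FirstReturn 62 cycleState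
cycleState-firstReturn = z<s , cycleState-period , λ where
    -- The bounded check starts at 0, so the positive times below 62 are shifted down by one.
    (suc k) _ k<62 → noEarlierReturn (s<s⁻¹ k<62)
  where
  noEarlierReturn : ∀ {k} → k < 61 → playTricks (suc k) cycleState ≢ just cycleState
  noEarlierReturn = from-yes (allUpTo? (λ k → ¬? (leadsTo? cycleState (suc k) cycleState)) 61)

-- From a state at backward distance at most 6 from the cycle, at most 6 + 61
-- tricks lead to `cycleState` itself.
LeadsToCycleState : State → Set
LeadsToCycleState s = ∃[ n ] (n < 67 × LeadsTo cycleState (suc n) s)

leadsToCycleState? : ∀ s → Dec (LeadsToCycleState s)
leadsToCycleState? s = anyUpTo? (λ n → leadsTo? cycleState (suc n) s) 67

leadsToCycleState⇒reachesCycle : ∀ s → LeadsToCycleState s → ReachesCycle s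
-- Play is followed past its entry into the cycle up to `cycleState`, which has index 0 on the
-- cycle.
leadsToCycleState⇒reachesCycle _ (n , _ , eq) = suc n , cycleState , eq , 0 , z<s , refl

leadsToCycleState⇒nonTerminating : ∀ s → LeadsToCycleState s → NonTerminating s
leadsToCycleState⇒nonTerminating s (n , _ , eq) =
  leadsToPeriodic⇒nonTerminating cycleState 61 cycleState-period n s eq

-- Any character other than the four court letters, in particular the hyphen, stands for a number
-- card. Deck composition is checked on the decoded hands.
card : Char → Card
card c =
  if fromChar c == "A" then A else
  if fromChar c == "K" then K else
  if fromChar c == "Q" then Q else
  if fromChar c == "J" then J else -

deal : String → String → Player → State
deal s t = state (map card (toList s)) (map card (toList t))

-- Each deal started by `player₂` is followed by its twin: the last number card of the first hand
-- moves to the top and `player₁` starts. As `player₁` wins the first trick in both, they merge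
-- after it.
deals : Vec State 30
deals =
  deal "--K---Q-KQAJ-----AAJ--J---" "----------Q----KQ-J-----KA" player₂ ∷
  deal "---K---Q-KQAJ-----AAJ--J--" "----------Q----KQ-J-----KA" player₁ ∷
  deal "--K---Q-KQAJA----AAJ--J---" "----------Q----KQ--J-----K" player₂ ∷
  deal "---K---Q-KQAJA----AAJ--J--" "----------Q----KQ--J-----K" player₁ ∷
  deal "---K---Q-KQAJ-A----AAJ--J-" "-----------Q----KQ-K-J----" player₂ ∷
  deal "----K---Q-KQAJ-A----AAJ--J" "-----------Q----KQ-K-J----" player₁ ∷
  deal "--K---A-KQQJ-----AAJ--J---" "----------Q----KQ-J-----KA" player₂ ∷
  deal "---K---A-KQQJ-----AAJ--J--" "----------Q----KQ-J-----KA" player₁ ∷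
  deal "--K---A-KQQJA----AAJ--J---" "----------Q----KQ--J-----K" player₂ ∷
  deal "---K---A-KQQJA----AAJ--J--" "----------Q----KQ--J-----K" player₁ ∷
  deal "---K---A-KQQJ-A----AAJ--J-" "-----------Q----KQ-K-J----" player₂ ∷
  deal "----K---A-KQQJ-A----AAJ--J" "-----------Q----KQ-K-J----" player₁ ∷
  deal "K---Q-KAQJ--KAAJ--J--Q----" "-------------KQ-J--------A" player₁ ∷
  deal "K---Q-KAQJA-KAAJ--J--Q----" "-------------KQ--J--------" player₁ ∷
  deal "K---Q-KAQJ-A-KAAJ--J--Q---" "--------------KQ---J------" player₂ ∷
  deal "-K---Q-KAQJ-A-KAAJ--J--Q--" "--------------KQ---J------" player₁ ∷
  deal "-K---Q-KAQJ--A-KAAJ--J--Q-" "---------------KQ----J----" player₂ ∷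
  deal "--K---Q-KAQJ--A-KAAJ--J--Q" "---------------KQ----J----" player₁ ∷
  deal "K---Q-KQQJ--KAAJ--J--Q----" "-------------KA-J--------A" player₁ ∷
  deal "K---Q-KQQJA-KAAJ--J--Q----" "-------------KA--J--------" player₁ ∷
  deal "K---Q-KQQJ-A-KAAJ--J--Q---" "--------------KA---J------" player₂ ∷
  deal "-K---Q-KQQJ-A-KAAJ--J--Q--" "--------------KA---J------" player₁ ∷
  deal "-K---Q-KQQJ--A-KAAJ--J--Q-" "---------------KA----J----" player₂ ∷
  deal "--K---Q-KQQJ--A-KAAJ--J--Q" "---------------KA----J----" player₁ ∷
  deal "Q-K---Q-KAQJ---A-KAAJ--J--" "----------------KQ-----J--" player₁ ∷
  deal "Q-K---Q-KAQJ----A-KAAJ--J-" "-----------------KQ------J" player₂ ∷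
  deal "-Q-K---Q-KAQJ----A-KAAJ--J" "-----------------KQ------J" player₁ ∷
  deal "Q-K---Q-KQQJ---A-KAAJ--J--" "----------------KA-----J--" player₁ ∷
  deal "Q-K---Q-KQQJ----A-KAAJ--J-" "-----------------KA------J" player₂ ∷
  deal "-Q-K---Q-KQQJ----A-KAAJ--J" "-----------------KA------J" player₁ ∷
  []

deals-unique : Unique deals
deals-unique = from-yes (allPairs? (λ s t → ¬? (s ≟ˢ t)) deals)

deals-startingDeal : All StartingDeal deals
deals-startingDeal =
  All.map (λ {s} → startingDealBySorting⇒startingDeal s) (from-yes (All.all? startingDealBySorting? deals))

deals-leadToCycleState : All LeadsToCycleState deals
deals-leadToCycleState = from-yes (All.all? leadsToCycleState? deals)

mainTheorem2 : FirstReturn 62 cycleState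
    × (∃[ deals ] (Unique {n = 30} deals
    × All StartingDeal deals
    × All ReachesCycle deals
    × All NonTerminating deals))
mainTheorem2 =
  cycleState-firstReturn ,
  deals ,
  deals-unique ,
  deals-startingDeal ,
  All.map (λ {s} → leadsToCycleState⇒reachesCycle s) deals-leadToCycleState ,
  All.map (λ {s} → leadsToCycleState⇒nonTerminating s) deals-leadToCycleState
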